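{- Let $k\ge2$ and $n\ge1$. For every permutation $P$ of $\{1,\dots,k^n\}$, there is a strategy for labeled chip-firing starting with $k^{2n}$ chips labeled $1,\dots,k^{2n}$ at the root of the infinite rooted directed $k$-ary tree whose stable configuration (a permutation of $\{1,\dots,k^{2n}\}$) contains a subsequence of length $k^n$ that is order-isomorphic to $P$.
   Context: Labeled chip-firing on the infinite rooted directed $k$-ary tree (each vertex has $k$ children ordered left to right, root on layer $1$): a vertex with at least $k$ chips may fire by choosing any $k$ of its chips and sending the $i$-th smallest label among them to its $i$-th leftmost child. A strategy is a sequence of legal firings continued until no vertex has $\ge k$ chips. Starting with $k^p$ chips at the root, every stable configuration has exactly one chip on each vertex of layer $p+1$ and none elsewhere, and is identified with the permutation of labels read left to right on layer $p+1$. A sequence $w_1,\dots,w_n$ of distinct numbers is order-isomorphic to a permutation $\sigma\in S_n$ if, for each $j$, $w_j$ is the $\sigma_j$-th smallest of $w_1,\dots,w_n$. -}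

module Defs where

open import Data.Fin.Base using (Fin; toℕ; _<_)
open import Data.Fin.Permutation using (Permutation′; _⟨$⟩ʳ_)
import Data.Fin.Properties as Fin
open import Data.List.Base using (List; []; _∷ʳ_; length)
open import Data.List.Properties using (≡-dec)
open import Data.List.Relation.Binary.Lex.Strict using (Lex-<)
open import Data.Nat.Base as ℕ using (ℕ; _^_)
open import Data.Product.Base using (_×_)
open import Data.Vec.Base using (allFin; count)
open import Relation.Binary.Core using (_Preserves_⟶_)
open import Relation.Binary.PropositionalEquality.Core using (_≡_; _≢_)

-- A vertex is the path leading to it from the root: its entries are the
-- (0-based, left-to-right) indices of the children chosen on the way down.
-- The root is [], and layer p + 1 consists of the paths of length p.

Vertex : ℕ → Set
Vertex k = List (Fin k)

root : ∀ {k} → Vertex k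
root = []

child : ∀ {k} → Vertex k → Fin k → Vertex k
child v i = v ∷ʳ i

-- On vertices of the same layer this is the left-to-right order.

_LeftOf_ : ∀ {k} → Vertex k → Vertex k → Set
_LeftOf_ = Lex-< _≡_ _<_

-- The chip x : Fin N carries the label toℕ x + 1.  Each label occurs exactly
-- once, so a configuration is given by the position of every chip.

Config : ℕ → ℕ → Set
Config k N = Fin N → Vertex k

allAtRoot : ∀ {k N} → Config k N
allAtRoot _ = root

chipsAt : ∀ {k N} → Config k N → Vertex k → ℕ
chipsAt c v = count (λ x → ≡-dec Fin._≟_ (c x) v) (allFin _)

-- The k fired chips are listed by increasing label, so that `chip i` is the one
-- sent to the i-th child from the left.

record Fires {k N : ℕ} (c c′ : Config k N) : Set where
  field
    vertex     : Vertex k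
    chip       : Fin k → Fin N
    increasing : chip Preserves _<_ ⟶ _<_
    present    : ∀ i → c (chip i) ≡ vertex
    moved      : ∀ i → c′ (chip i) ≡ child vertex i
    unmoved    : ∀ x → (∀ i → x ≢ chip i) → c′ x ≡ c x

Stable : ∀ {k N} → Config k N → Set
Stable {k} c = ∀ v → chipsAt c v ℕ.< k

-- Permutations are in one-line notation: π ⟨$⟩ʳ j is the entry at position j.
-- `Reads p c π` says that π lists the chips of c from left to right along layer
-- p + 1.  Since there are k ^ p chips, as many as vertices on that layer, it
-- forces exactly one chip on each vertex of the layer and none elsewhere.

Reads : ∀ {k} p → Config k (k ^ p) → Permutation′ (k ^ p) → Set
Reads p c π =
  (∀ j → length (c (π ⟨$⟩ʳ j)) ≡ p) ×
  ((λ j → c (π ⟨$⟩ʳ j)) Preserves _<_ ⟶ _LeftOf_)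

-- "w j is the (σ j)-th smallest entry of w", with ranks counted from 0: exactly
-- toℕ (σ j) entries of w are smaller than w j.

OrderIsomorphic : ∀ {m N} → (Fin m → Fin N) → Permutation′ m → Set
OrderIsomorphic w σ =
  ∀ j → count (λ i → w i Fin.<? w j) (allFin _) ≡ toℕ (σ ⟨$⟩ʳ j)

{-# OPTIONS --safe #-}

-- Write a label as a pair (a , b) of numbers below kⁿ, with a the block of kⁿ
-- consecutive labels containing it.  During the first n layers only fire chips
-- of a common block that differ in one base-k digit of b, and during the next n
-- layers only chips with a common b that differ in one digit of a.  After the
-- first phase each vertex of layer n + 1 holds one chip from every block; after
-- the second, (a , b) stands at place (b , a) of the last layer.  Below the j-th
-- vertex of layer n + 1 select the chip of block P j.
module Submission where

open import Defs
import Data.Nat.Properties as ℕ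
open import Algebra.Properties.CommutativeMonoid.Sum ℕ.+-0-commutativeMonoid
  using (sum; sum-cong-≗; sum-permute; sum-replicate-zero)
open import Data.Bool.Base using (if_then_else_; true; false)
open import Data.Fin.Base using (Fin; zero; suc; toℕ; combine; remQuot; _<_)
open import Data.Fin.Permutation
  using (Permutation′; _⟨$⟩ʳ_; _⟨$⟩ˡ_; inverseʳ; permutation)
open import Data.Fin.Properties
  using (_≟_; _<?_; <-cmp; <-irrefl; any?; combine-injective; combine-monoˡ-<;
         combine-remQuot; combine-surjective; remQuot-combine; toℕ-combine; 0≢1+n;
         suc-injective)
open import Data.List.Base using ([]; _∷_; _++_; length)
open import Data.List.Properties using (++-assoc; ++-identityʳ; length-++; ≡-dec)
open import Data.List.Relation.Binary.Lex.Strict using (this; next; <-irreflexive)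
open import Data.List.Relation.Binary.Pointwise using (≡⇒Pointwise-≡)
open import Data.Nat.Base as ℕ using (ℕ; zero; suc; _+_; _*_; _^_; _≤_; z≤n; s≤s)
open import Data.Product.Base
  using (Σ-syntax; _×_; _,_; proj₁; proj₂; swap; uncurry)
open import Data.Sum.Base using (_⊎_; inj₁; inj₂)
open import Data.Vec.Base using (allFin; count; tabulate)
open import Function.Base using (_∘_; id; const)
open import Function.Bundles using (_⇔_; mk⇔; module Injection)
open import Function.Definitions using (Injective; StrictlySurjective)
open import Function.Properties.Inverse using (↔⇒↣)
open import Level using (0ℓ)
open import Relation.Binary.Core using (Rel; _Preserves_⟶_)
open import Relation.Binary.Construct.Closure.ReflexiveTransitive using (Star; ε; _◅_; _◅◅_)
open import Relation.Binary.Definitions using (Irreflexive; tri<; tri≈; tri>)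
open import Relation.Binary.PropositionalEquality
  using (_≡_; _≢_; refl; sym; trans; cong; cong₂; subst; subst₂; module ≡-Reasoning)
open import Relation.Nullary using (Dec; does; yes; no; ¬_; contradiction)
open import Relation.Nullary.Decidable using (does-⇔)
open import Relation.Unary using (Pred; Decidable)

private
  variable
    k m n N : ℕ
    A B : Set

-- Monotone maps and the order on two-digit numbers.

-- Only irreflexivity of the target relation is asked for, so this serves both labels under `_<_`
-- and vertices under `_LeftOf_`.
increasing⇒injective : {_∼_ : Rel A 0ℓ} {f : Fin m → A} →
  Irreflexive _≡_ _∼_ → f Preserves _<_ ⟶ _∼_ → Injective _≡_ _≡_ f
increasing⇒injective irr mono {i} {j} eq with <-cmp i j
... | tri< i<j _ _ = contradiction (mono i<j) (irr eq)
... | tri≈ _ i≡j _ = i≡j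
... | tri> _ _ j<i = contradiction (mono j<i) (irr (sym eq))

combine-monoʳ-< : (i : Fin m) → combine {n = n} i Preserves _<_ ⟶ _<_
combine-monoʳ-< {n = n} i {x} {y} x<y =
  subst₂ ℕ._<_ (sym (toℕ-combine i x)) (sym (toℕ-combine i y))
    (ℕ.+-monoʳ-< (n * toℕ i) x<y)

combine-cancel-< : (i i′ : Fin m) (j j′ : Fin n) →
  combine i j < combine i′ j′ → i < i′ ⊎ (i ≡ i′ × j < j′)
combine-cancel-< {n = n} i i′ j j′ lt with <-cmp i i′
... | tri< i<i′ _ _ = inj₁ i<i′
... | tri≈ _ refl _ = inj₂ (refl , ℕ.+-cancelˡ-< (n * toℕ i) _ _
        (subst₂ ℕ._<_ (toℕ-combine i j) (toℕ-combine i j′) lt))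
... | tri> _ _ i′<i = contradiction lt (ℕ.<-asym (combine-monoˡ-< j′ j i′<i))

-- Counting, ranks and stability.

indicator : {X : Set} → Dec X → ℕ
indicator d = if does d then 1 else 0

count≡sum : {Q : Pred A 0ℓ} (Q? : Decidable Q) (f : Fin n → A) →
  count Q? (tabulate f) ≡ sum (λ i → indicator (Q? (f i)))
count≡sum {n = zero}  Q? f = refl
count≡sum {n = suc n} Q? f with does (Q? (f zero))
... | true  = cong suc (count≡sum Q? (f ∘ suc))
... | false = count≡sum Q? (f ∘ suc)

sum-indicator-< : (x : Fin n) → sum {n} (λ i → indicator (i <? x)) ≡ toℕ x
sum-indicator-< {suc n} zero    = sum-replicate-zero n
sum-indicator-< {suc n} (suc x) = cong suc (sum-indicator-< x)

-- As a sum of indicators the count is invariant under reindexing by `π`, which leaves the number of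
-- `i` below `x`. The predicate `Q` is free so that comparisons of labels can be replaced by
-- comparisons of values of `π`.
count-permuted-< : (π : Permutation′ n) (x : Fin n) {Q : Pred (Fin n) 0ℓ}
  (Q? : Decidable Q) → (∀ i → Q i ⇔ (π ⟨$⟩ʳ i < x)) → count Q? (allFin n) ≡ toℕ x
count-permuted-< {n} π x Q? Q⇔< = begin
  count Q? (allFin n)                      ≡⟨ count≡sum Q? id ⟩
  sum (λ i → indicator (Q? i))             ≡⟨ sum-cong-≗ (λ i → cong (if_then 1 else 0)
                                                (does-⇔ (Q⇔< i) (Q? i) (π ⟨$⟩ʳ i <? x))) ⟩
  sum (λ i → indicator (π ⟨$⟩ʳ i <? x))    ≡⟨ sum-permute (λ i → indicator (i <? x)) π ⟨
  sum {n} (λ i → indicator (i <? x))       ≡⟨ sum-indicator-< x ⟩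
  toℕ x                                    ∎
  where open ≡-Reasoning

count-none : {Q : Pred A 0ℓ} (Q? : Decidable Q) (f : Fin n → A) →
  (∀ i → ¬ Q (f i)) → count Q? (tabulate f) ≡ 0
count-none {n = zero}  Q? f ¬Q = refl
count-none {n = suc n} Q? f ¬Q with Q? (f zero)
... | yes q = contradiction q (¬Q zero)
... | no _  = count-none Q? (f ∘ suc) (¬Q ∘ suc)

count-unique : {Q : Pred A 0ℓ} (Q? : Decidable Q) (f : Fin n → A) →
  (∀ {i j} → Q (f i) → Q (f j) → i ≡ j) → count Q? (tabulate f) ≤ 1
count-unique {n = zero}  Q? f uniq = z≤n
count-unique {n = suc n} Q? f uniq with Q? (f zero)
... | yes q = s≤s (ℕ.≤-reflexive
                (count-none Q? (f ∘ suc) (λ i q′ → 0≢1+n (uniq q q′))))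
... | no _  = count-unique Q? (f ∘ suc) (λ q q′ → suc-injective (uniq q q′))

injective⇒stable : 2 ≤ k → (c : Config k N) → Injective _≡_ _≡_ c → Stable c
injective⇒stable 2≤k c inj v =
  ℕ.≤-trans (s≤s (count-unique (λ x → ≡-dec _≟_ (c x) v) id
    (λ p q → inj (trans p (sym q))))) 2≤k

-- Partial strategies and their composition.

-- A Hoare triple with a frame condition: only the chips `e a` are constrained at the start, the
-- others may be anywhere and are left where they are. This is what lets strategies for separate
-- families of chips be played one after another.
record Reaches (e : A → Fin N) (s t : A → Vertex k) : Set where
  constructor reaching
  field
    run : (c : Config k N) → (∀ a → c (e a) ≡ s a) →
      Σ[ c′ ∈ Config k N ] Star Fires c c′ ×
        (∀ a → c′ (e a) ≡ t a) × (∀ x → (∀ a → x ≢ e a) → c′ x ≡ c x)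

open Reaches

reaches-refl : {e : A → Fin N} {s t : A → Vertex k} →
  (∀ a → s a ≡ t a) → Reaches e s t
reaches-refl s≡t .run c start =
  c , ε , (λ a → trans (start a) (s≡t a)) , λ _ _ → refl

reaches-trans : {e : A → Fin N} {s t u : A → Vertex k} →
  Reaches e s t → Reaches e t u → Reaches e s u
reaches-trans r r′ .run c start
  with c₁ , play₁ , end₁ , rest₁ ← r .run c start
  with c₂ , play₂ , end₂ , rest₂ ← r′ .run c₁ end₁
  = c₂ , play₁ ◅◅ play₂ , end₂ , λ x x∉ → trans (rest₂ x x∉) (rest₁ x x∉)

reaches-reindex : {e : A → Fin N} {s t : A → Vertex k} {t′ : B → Vertex k}
  (f : B → A) → StrictlySurjective _≡_ f → (∀ b → t′ b ≡ t (f b)) →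
  Reaches (e ∘ f) (s ∘ f) t′ → Reaches e s t
reaches-reindex {e = e} {t = t} f surj t′≡t r .run c start
  with c₁ , play₁ , end₁ , rest₁ ← r .run c (start ∘ f)
  = c₁ , play₁ , end , λ x x∉ → rest₁ x (x∉ ∘ f)
  where
  end : ∀ a → c₁ (e a) ≡ t a
  end a with b , refl ← surj a = trans (end₁ b) (t′≡t b)

-- The families are played in turn. Since they share no chip, the frame condition keeps later
-- families at their starts and earlier ones at their ends.
reaches-parallel : (e : Fin m → A → Fin N) {s t : Fin m → A → Vertex k} →
  (∀ {i j a b} → e i a ≡ e j b → i ≡ j) →
  (∀ i → Reaches (e i) (s i) (t i)) →
  Reaches (uncurry e) (uncurry s) (uncurry t)
reaches-parallel {m = zero} e disjoint r .run c start =
  c , ε , (λ ()) , λ _ _ → refl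
reaches-parallel {m = suc m} e {t = t} disjoint r .run c start
  with c₁ , play₁ , end₁ , rest₁ ← r zero .run c (λ a → start (zero , a))
  with c₂ , play₂ , end₂ , rest₂ ←
    reaches-parallel (e ∘ suc) (suc-injective ∘ disjoint) (r ∘ suc) .run c₁
      (λ (i , a) → trans (rest₁ _ (λ b eq → 0≢1+n (sym (disjoint eq))))
                         (start (suc i , a)))
  = c₂ , play₁ ◅◅ play₂ , end , λ x x∉ →
      trans (rest₂ x (λ (i , a) → x∉ (suc i , a)))
            (rest₁ x (λ a → x∉ (zero , a)))
  where
  end : ∀ p → c₂ (uncurry e p) ≡ uncurry t p
  end (zero  , a) =
    trans (rest₂ _ (λ (i , b) eq → 0≢1+n (disjoint eq))) (end₁ a)
  end (suc i , a) = end₂ (i , a)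

reaches-fire : (v : Vertex k) (e : Fin k → Fin N) → e Preserves _<_ ⟶ _<_ →
  Reaches e (const v) (child v)
reaches-fire {k} {N} v e mono .run c start =
  fired , fires ◅ ε , Fires.moved fires , Fires.unmoved fires
  where
  fired : Config k N
  fired x with any? (λ i → x ≟ e i)
  ... | yes (i , _) = child v i
  ... | no _        = c x

  fired-moved : ∀ i → fired (e i) ≡ child v i
  fired-moved i with any? (λ j → e i ≟ e j)
  -- The search returns some index `j` of the chip `e i`; injectivity of `e` identifies it with `i`.
  ... | yes (j , eq) = cong (child v) (sym (increasing⇒injective <-irrefl mono eq))
  ... | no none      = contradiction (i , refl) none

  fired-unmoved : ∀ x → (∀ i → x ≢ e i) → fired x ≡ c x
  fired-unmoved x x∉ with any? (λ j → x ≟ e j)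
  ... | yes (j , eq) = contradiction eq (x∉ j)
  ... | no _         = refl

  fires : Fires c fired
  fires = record
    { vertex = v ; chip = e ; increasing = mono ; present = start
    ; moved = fired-moved ; unmoved = fired-unmoved }

-- Vertices of a layer as base-k expansions.

-- The `n`-digit base-k expansion, leading zeros included and most significant digit first, so that
-- numerical order becomes left-to-right order.
path : ∀ n → Fin (k ^ n) → Vertex k
path         zero    _ = []
path {k = k} (suc n) b = let i , b′ = remQuot {k} (k ^ n) b in i ∷ path n b′

path-combine : ∀ n (i : Fin k) (b : Fin (k ^ n)) →
  path (suc n) (combine i b) ≡ i ∷ path n b
path-combine n i b = cong (λ (i , b) → i ∷ path n b) (remQuot-combine i b)

length-path : ∀ n (b : Fin (k ^ n)) → length (path n b) ≡ n
length-path zero    b = refl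
length-path {k} (suc n) b = cong suc (length-path n (proj₂ (remQuot {k} (k ^ n) b)))

-- Two distinct words of equal length already differ inside that length, so arbitrary continuations
-- `u` and `v` cannot affect the comparison.
path-increasing : ∀ n {a b : Fin (k ^ n)} (u v : Vertex k) → a < b →
  (path n a ++ u) LeftOf (path n b ++ v)
path-increasing zero {zero} {zero} u v ()
path-increasing {k} (suc n) {a} {b} u v a<b
  with i , a′ , refl ← combine-surjective {k} {k ^ n} a
  with j , b′ , refl ← combine-surjective {k} {k ^ n} b
  = subst₂ (λ w w′ → (w ++ u) LeftOf (w′ ++ v))
      (sym (path-combine n i a′)) (sym (path-combine n j b′))
      (leftOf (combine-cancel-< i j a′ b′ a<b))
  where
  leftOf : i < j ⊎ (i ≡ j × a′ < b′) →
    (i ∷ path n a′ ++ u) LeftOf (j ∷ path n b′ ++ v)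
  leftOf (inj₁ i<j)           = this i<j
  leftOf (inj₂ (i≡j , a′<b′)) = next i≡j (path-increasing n u v a′<b′)

leftOf-++ˡ : (w : Vertex k) {u v : Vertex k} → u LeftOf v → (w ++ u) LeftOf (w ++ v)
leftOf-++ˡ []      lt = lt
leftOf-++ˡ (i ∷ w) lt = next refl (leftOf-++ˡ w lt)

leftOf-irrefl : Irreflexive _≡_ (_LeftOf_ {k})
leftOf-irrefl eq = <-irreflexive <-irrefl (≡⇒Pointwise-≡ eq)

-- The two phases of the strategy.

swap-surjective : StrictlySurjective _≡_ (swap {A = A} {B = B})
swap-surjective (a , b) = (b , a) , refl

-- Induction on `n`. One firing at `v` for each value `b` of the lower digits takes the `k` chips
-- that differ only in the leading digit `i`; monotonicity of `e` sends digit `i` to child `i`. The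
-- chips with leading digit `i` are then all at `child v i` and are spread below it.
reaches-spread : ∀ n (v : Vertex k) (e : Fin (k ^ n) → Fin N) →
  e Preserves _<_ ⟶ _<_ → Reaches e (const v) (λ b → v ++ path n b)
reaches-spread zero v e mono = reaches-refl (λ _ → sym (++-identityʳ v))
reaches-spread {k} (suc n) v e mono =
  reaches-reindex (uncurry combine)
    (λ b → let i , b′ , eq = combine-surjective {k} b in (i , b′) , eq)
    (λ (i , b) → trans (++-assoc v (i ∷ []) (path n b))
                       (cong (v ++_) (sym (path-combine n i b))))
    (reaches-trans
      -- The firings are grouped by the lower digits `b`, the recursion by the leading digit `i`;
      -- hence the swap of index pairs.
      (reaches-reindex swap swap-surjective (λ _ → refl)
        (reaches-parallel (λ b i → e (combine i b))
          (λ eq → proj₂ (combine-injective {k} _ _ _ _ (inj eq)))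
          (λ b → reaches-fire v _ (mono ∘ combine-monoˡ-< {m = k} b b))))
      (reaches-parallel (λ i b → e (combine i b))
        (λ eq → proj₁ (combine-injective _ _ _ _ (inj eq)))
        (λ i → reaches-spread n (child v i) _ (mono ∘ combine-monoʳ-< i))))
  where
  inj : Injective _≡_ _≡_ e
  inj = increasing⇒injective <-irrefl mono

reaches-transposed : ∀ n → Reaches {k = k} (uncurry (combine {k ^ n} {k ^ n}))
  (const root) (λ (a , b) → path n b ++ path n a)
reaches-transposed {k} n = reaches-trans
  (reaches-parallel combine (λ eq → proj₁ (combine-injective _ _ _ _ eq))
    -- Blocks descend one at a time while later blocks wait at the root, which is legal because a
    -- firing may choose any `k` of the chips present.
    (λ a → reaches-spread n root (combine a) (combine-monoʳ-< a)))
  (reaches-reindex swap swap-surjective (λ _ → refl)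
    (reaches-parallel (λ b a → combine a b)
      (λ eq → proj₂ (combine-injective {k ^ n} _ _ _ _ eq))
      (λ b → reaches-spread n (path n b) _ (combine-monoˡ-< {m = k ^ n} b b))))

-- The stable permutation and its subsequence.

-- Transposition of a square array numbered row by row. For `m` equal to `k ^ n` it is the stable
-- permutation in one-line notation: place `(a , b)` holds label `(b , a)`.
transposeDigits : ∀ m → Permutation′ (m * m)
transposeDigits m = permutation flipped flipped involutive involutive
  where
  flipped : Fin (m * m) → Fin (m * m)
  flipped = uncurry combine ∘ swap ∘ remQuot {m} m

  involutive : ∀ x → flipped (flipped x) ≡ x
  involutive x = let a , b = remQuot {m} m x in
    trans (cong (uncurry combine ∘ swap) (remQuot-combine b a)) (combine-remQuot {m} m x)

transposeDigits-combine : (a b : Fin m) →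
  transposeDigits m ⟨$⟩ʳ combine a b ≡ combine b a
transposeDigits-combine a b = cong (uncurry combine ∘ swap) (remQuot-combine a b)

-- The conclusion with the number N of chips freed from being syntactically
-- k ^ p, so that it can be shown for kⁿ * kⁿ chips and then transported.
Contains : (k p : ℕ) → Permutation′ m → ℕ → Set
Contains {m} k p P N =
  Σ[ c ∈ Config k N ]
    Star Fires allAtRoot c × Stable c ×
    (Σ[ π ∈ Permutation′ N ]
      ((∀ j → length (c (π ⟨$⟩ʳ j)) ≡ p) ×
       (λ j → c (π ⟨$⟩ʳ j)) Preserves _<_ ⟶ _LeftOf_) ×
      (Σ[ position ∈ (Fin m → Fin N) ]
        position Preserves _<_ ⟶ _<_ ×
        OrderIsomorphic (λ j → π ⟨$⟩ʳ position j) P))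

contains-square : ∀ n → 2 ≤ k → (P : Permutation′ (k ^ n)) →
  Contains k (2 * n) P (k ^ n * k ^ n)
contains-square {k} n 2≤k P
  with c , play , end , _ ← reaches-transposed {k} n .run allAtRoot (λ _ → refl)
  = c , play , injective⇒stable 2≤k c c-injective , π , (layer , increasing) ,
    position , (λ i<j → combine-monoˡ-< _ _ i<j) , isomorphic
  where
  M : ℕ
  M = k ^ n

  π : Permutation′ (M * M)
  π = transposeDigits M

  c∘π : ∀ a b → c (π ⟨$⟩ʳ combine a b) ≡ path n a ++ path n b
  c∘π a b = trans (cong c (transposeDigits-combine a b)) (end (b , a))

  layer : ∀ j → length (c (π ⟨$⟩ʳ j)) ≡ 2 * n
  layer j with a , b , refl ← combine-surjective {M} {M} j = begin
    length (c (π ⟨$⟩ʳ combine a b))         ≡⟨ cong length (c∘π a b) ⟩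
    length (path n a ++ path n b)           ≡⟨ length-++ (path n a) ⟩
    length (path n a) + length (path n b)   ≡⟨ cong₂ _+_ (length-path n a) (length-path n b) ⟩
    n + n                                   ≡⟨ cong (n +_) (ℕ.+-identityʳ n) ⟨
    2 * n                                   ∎
    where open ≡-Reasoning

  increasing : (λ j → c (π ⟨$⟩ʳ j)) Preserves _<_ ⟶ _LeftOf_
  increasing {i} {j} i<j
    with a , b , refl ← combine-surjective {M} {M} i
    with a′ , b′ , refl ← combine-surjective {M} {M} j
    = subst₂ _LeftOf_ (sym (c∘π a b)) (sym (c∘π a′ b′))
        (leftOf (combine-cancel-< a a′ b b′ i<j))
    where
    leftOf : a < a′ ⊎ (a ≡ a′ × b < b′) →
      (path n a ++ path n b) LeftOf (path n a′ ++ path n b′)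
    -- Different ancestors on layer n + 1 decide the order, whatever the second halves are.
    leftOf (inj₁ a<a′)         = path-increasing n _ _ a<a′
    leftOf (inj₂ (refl , b<b′)) = leftOf-++ˡ (path n a)
      (subst₂ _LeftOf_ (++-identityʳ _) (++-identityʳ _) (path-increasing n [] [] b<b′))

  c-injective : Injective _≡_ _≡_ c
  c-injective {x} {y} eq = begin
    x                      ≡⟨ inverseʳ π ⟨
    -- Reading along the layer is strictly increasing, so `c` composed with `π` is injective; as `π`
    -- is a bijection, so is `c` itself injective.
    π ⟨$⟩ʳ (π ⟨$⟩ˡ x)      ≡⟨ cong (π ⟨$⟩ʳ_) (increasing⇒injective leftOf-irrefl increasing
                                (trans (cong c (inverseʳ π)) (trans eq (cong c (sym (inverseʳ π)))))) ⟩
    π ⟨$⟩ʳ (π ⟨$⟩ˡ y)      ≡⟨ inverseʳ π ⟩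
    y                      ∎
    where open ≡-Reasoning

  -- The leading digit `j` makes the places increase, and the second digit `P j` becomes the leading
  -- digit of the label found there.
  position : Fin M → Fin (M * M)
  position j = combine j (P ⟨$⟩ʳ j)

  label : ∀ j → π ⟨$⟩ʳ position j ≡ combine (P ⟨$⟩ʳ j) j
  label j = transposeDigits-combine j (P ⟨$⟩ʳ j)

  isomorphic : OrderIsomorphic (λ j → π ⟨$⟩ʳ position j) P
  isomorphic j = count-permuted-< P (P ⟨$⟩ʳ j) _ (λ i → mk⇔
    (λ lt → reflects (combine-cancel-< _ _ i j (subst₂ _<_ (label i) (label j) lt)))
    (λ lt → subst₂ _<_ (sym (label i)) (sym (label j)) (combine-monoˡ-< i j lt)))
    where
    P-injective : ∀ {i} → P ⟨$⟩ʳ i ≡ P ⟨$⟩ʳ j → i ≡ j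
    P-injective = Injection.injective (↔⇒↣ P)

    -- Labels are compared by their leading digits `P i` and `P j`. A tie would force `i ≡ j`, so
    -- the second digits never decide.
    reflects : ∀ {i} → P ⟨$⟩ʳ i < P ⟨$⟩ʳ j ⊎ (P ⟨$⟩ʳ i ≡ P ⟨$⟩ʳ j × i < j) →
      P ⟨$⟩ʳ i < P ⟨$⟩ʳ j
    reflects (inj₁ lt)        = lt
    reflects (inj₂ (eq , i<j)) = contradiction i<j (<-irrefl (P-injective eq))

theorem4p2 : (k n : ℕ) → 2 ≤ k → 1 ≤ n → (P : Permutation′ (k ^ n)) →
    Σ[ c ∈ Config k (k ^ (2 * n)) ]
    Star Fires allAtRoot c × Stable c ×
    (Σ[ π ∈ Permutation′ (k ^ (2 * n)) ]
    Reads (2 * n) c π ×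
    (Σ[ position ∈ (Fin (k ^ n) → Fin (k ^ (2 * n))) ]
    position Preserves _<_ ⟶ _<_ ×
    OrderIsomorphic (λ j → π ⟨$⟩ʳ position j) P))
theorem4p2 k n 2≤k _ P = subst (Contains k (2 * n) P) square (contains-square n 2≤k P)
  where
  square : k ^ n * k ^ n ≡ k ^ (2 * n)
  square = begin
    k ^ n * k ^ n   ≡⟨ ℕ.^-distribˡ-+-* k n n ⟨
    k ^ (n + n)     ≡⟨ cong (λ m → k ^ (n + m)) (ℕ.+-identityʳ n) ⟨
    k ^ (2 * n)     ∎
    where open ≡-Reasoning
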